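{- Let $\mathcal P=\{P_1,\dots,P_K\}$ be a finite collection of prototiles, with $P_k=\{0=p_{k,1}<p_{k,2}<\dots<p_{k,\ell_k}\}$. Then the subscripted tiling system $\widetilde T(\mathcal P)$ is a shift of finite type. More precisely, if $L$ is the maximal length $p_{k,\ell_k}+1$ of a prototile in $\mathcal P$, then a point $x\in\prod_{i\in\mathbb Z}\{(k,\ell):1\le k\le K,1\le \ell\le \ell_k\}$ belongs to $\widetilde T(\mathcal P)$ whenever every block of $L$ consecutive symbols occurring in $x$ occurs in some point of $\widetilde T(\mathcal P)$.
   Context: A prototile is a finite nonempty subset of $\mathbb Z$ with minimum $0$. The subscripted tiling system $\widetilde T(\mathcal P)$ is the set of points $x\in\prod_{i\in\mathbb Z}\{(k,\ell):1\le k\le K,\ 1\le\ell\le\ell_k\}$ such that there is a tiling $\mathbb Z=\bigcup_j(t_j+P_{k_j})$ of $\mathbb Z$ as a disjoint union of translates of prototiles with the property that for every $i$ there are $j$ and $\ell$ with $i\in t_j+P_{k_j}$ (namely $i=t_j+p_{k_j,\ell}$) and $x_i=(k_j,\ell)$. Equivalently, $x\in\widetilde T(\mathcal P)$ iff for every $i$, $x_i=(k,\ell)$ and $1\le\ell'\le\ell_k$ imply $x_{i+p_{k,\ell'}-p_{k,\ell}}=(k,\ell')$. It is considered with the shift $(\sigma x)_i=x_{i+1}$. -}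

module Defs where

open import Level using (Level; 0ℓ)
open import Data.Nat.Base as ℕ using (ℕ; suc; _⊔_)
open import Data.Integer.Base as ℤ using (ℤ; 0ℤ; +_; ∣_∣)
open import Data.Fin.Base as Fin using (Fin; zero; toℕ; fromℕ)
open import Data.List.Base using (List)
open import Data.List.Relation.Unary.All using (All)
open import Data.Vec.Base using (Vec; lookup)
open import Data.Vec.Functional using (foldr)
open import Data.Product.Base using (Σ; ∃; ∃-syntax; _×_; _,_; proj₂)
open import Function.Base using (_∘_)
open import Function.Bundles using (_⇔_)
open import Relation.Nullary.Negation.Core using (¬_)
open import Relation.Unary using (Pred)
open import Relation.Binary.PropositionalEquality.Core using (_≡_)

private
  variable
    a ℓ : Level
    A : Set a
    n K : ℕ

-- Symbolic dynamics over an alphabet A: points are bi-infinite sequences ℤ → A.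

_OccursIn_ : Vec A n → (ℤ → A) → Set _
w OccursIn x = ∃[ i ] ∀ m → x (i ℤ.+ + toℕ m) ≡ lookup w m

-- X consists of exactly the points in which no block from a finite list of
-- forbidden blocks (of possibly different lengths) occurs.  Such an X is
-- automatically closed and invariant under the shift (σ x) i = x (i + 1).
IsShiftOfFiniteType : {A : Set a} → Pred (ℤ → A) ℓ → Set _
IsShiftOfFiniteType {A = A} X =
  Σ (List (∃ (Vec A))) λ F →
    ∀ x → X x ⇔ All (λ w → ¬ (proj₂ w OccursIn x)) F

-- A finite nonempty subset of ℤ with minimum 0, given by its increasing
-- enumeration.  Subscripts start at zero: `elem zero` is p₁ and
-- `elem (fromℕ size-1)` is the largest element.
record Prototile : Set where
  field
    size-1     : ℕ
    elem       : Fin (suc size-1) → ℤ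
    elem-first : elem zero ≡ 0ℤ
    elem-mono  : ∀ {l m} → l Fin.< m → elem l ℤ.< elem m

  size : ℕ
  size = suc size-1

  -- The largest element is nonnegative, so ∣_∣ only turns it into a natural.
  length : ℕ
  length = suc ∣ elem (fromℕ size-1) ∣

open Prototile public

_∈_+ₜ_ : ℤ → ℤ → Prototile → Set
i ∈ t +ₜ P = ∃[ l ] i ≡ t ℤ.+ elem P l

-- A family of translates t j + P (kind j) whose disjoint union is ℤ.
-- `disjoint` is the positive form of "tiles with different indices are disjoint".
record Tiling (𝒫 : Fin K → Prototile) : Set₁ where
  field
    Index    : Set
    t        : Index → ℤ
    kind     : Index → Fin K
    covers   : ∀ i → ∃[ j ] i ∈ t j +ₜ 𝒫 (kind j)
    disjoint : ∀ {i j j′} → i ∈ t j +ₜ 𝒫 (kind j) → i ∈ t j′ +ₜ 𝒫 (kind j′) → j ≡ j′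

Symbol : (Fin K → Prototile) → Set
Symbol {K} 𝒫 = Σ (Fin K) λ k → Fin (size (𝒫 k))

SubscriptedTilingSystem : (𝒫 : Fin K → Prototile) → Pred (ℤ → Symbol 𝒫) _
SubscriptedTilingSystem 𝒫 x =
  Σ (Tiling 𝒫) λ τ → let open Tiling τ in
    ∀ i → ∃[ j ] ∃[ l ] (i ≡ t j ℤ.+ elem (𝒫 (kind j)) l × x i ≡ (kind j , l))

maxLength : (Fin K → Prototile) → ℕ
maxLength 𝒫 = foldr _⊔_ 0 (length ∘ 𝒫)

{-# OPTIONS --safe #-}

-- Membership in the subscripted tiling system is a local condition: as soon as
-- the symbol (k , l) is seen at position s + p_{k,l}, the symbol (k , l′) has to
-- be seen at every s + p_{k,l′}.  Conversely, if x satisfies this, the positions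
-- carrying a first subscript (k , zero) are the base points of a tiling.
-- All positions of a tile lie in one window of length maxLength 𝒫, so the
-- condition can be read off the windows, and the inconsistent words of that
-- length are the forbidden blocks.

module Submission where

open import Data.Nat.Base as ℕ using (ℕ; suc; s≤s)
import Data.Nat.Properties as ℕ
open import Data.Integer.Base as ℤ using (ℤ; 0ℤ; +_; ∣_∣)
import Data.Integer.Properties as ℤ
open import Data.Integer.Tactic.RingSolver using (solve-∀)
open import Algebra.Properties.AbelianGroup ℤ.+-0-abelianGroup using (∙-cancelˡ; ∙-cancelʳ)
open import Data.Fin.Base as Fin using (Fin; zero; suc; toℕ; fromℕ<)
import Data.Fin.Properties as Fin
open import Data.List.Base as List using (List; []; _∷_)
open import Data.List.Membership.Propositional using (_∈_; lose)
open import Data.List.Membership.Propositional.Properties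
  using (∈-map⁺; ∈-allFin; ∈-concatMap⁺; ∈-cartesianProductWith⁺; ∈-filter⁺)
open import Data.List.Relation.Unary.Any using (here)
open import Data.List.Relation.Unary.All as All using (All)
import Data.List.Relation.Unary.All.Properties as All
open import Data.Vec.Base using (Vec; []; _∷_; lookup; tabulate)
open import Data.Vec.Properties using (lookup∘tabulate)
open import Data.Product.Base using (∃; ∃-syntax; _×_; _,_; proj₁; proj₂)
open import Data.Product.Properties using (≡-dec; ,-injectiveˡ)
open import Function.Base using (_∘_)
open import Function.Bundles using (mk⇔)
open import Relation.Binary.Definitions using (DecidableEquality; tri<; tri≈; tri>)
open import Relation.Binary.PropositionalEquality
open import Relation.Nullary.Decidable using (Dec; ¬?; _→-dec_; decidable-stable)
open import Relation.Nullary.Negation using (¬_; contradiction)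
open import Axiom.UniquenessOfIdentityProofs using (module Decidable⇒UIP)
open import Defs

private
  variable
    K n : ℕ
    A : Set

words : List A → (n : ℕ) → List (Vec A n)
words as ℕ.zero  = [] ∷ []
words as (suc n) = List.cartesianProductWith _∷_ as (words as n)

∈-words : {as : List A} → (∀ a → a ∈ as) → (w : Vec A n) → w ∈ words as n
∈-words all []      = here refl
∈-words all (a ∷ w) = ∈-cartesianProductWith⁺ _∷_ (all a) (∈-words all w)

window : (ℤ → A) → ℤ → (n : ℕ) → Vec A n
window x i n = tabulate λ m → x (i ℤ.+ + toℕ m)

window-occurs : (x : ℤ → A) (i : ℤ) → window x i n OccursIn x
window-occurs x i = i , λ m → sym (lookup∘tabulate _ m)

module _ (P : Prototile) where

  elem-injective : ∀ {l m} → elem P l ≡ elem P m → l ≡ m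
  elem-injective {l} {m} eq with Fin.<-cmp l m
  ... | tri< l<m _ _ = contradiction eq (ℤ.<⇒≢ (elem-mono P l<m))
  ... | tri≈ _ l≡m _ = l≡m
  ... | tri> _ _ m<l = contradiction (sym eq) (ℤ.<⇒≢ (elem-mono P m<l))

  elem-mono-≤ : ∀ {l m} → l Fin.≤ m → elem P l ℤ.≤ elem P m
  elem-mono-≤ {l} {m} l≤m with Fin.<-cmp l m
  ... | tri< l<m _ _ = ℤ.<⇒≤ (elem-mono P l<m)
  ... | tri≈ _ l≡m _ = ℤ.≤-reflexive (cong (elem P) l≡m)
  ... | tri> _ _ m<l = contradiction m<l (ℕ.≤⇒≯ l≤m)

  elem-nonNegative : ∀ l → 0ℤ ℤ.≤ elem P l
  elem-nonNegative l = subst (ℤ._≤ elem P l) (elem-first P) (elem-mono-≤ ℕ.z≤n)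

  +∣elem∣ : ∀ l → + ∣ elem P l ∣ ≡ elem P l
  +∣elem∣ l = ℤ.0≤i⇒+∣i∣≡i (elem-nonNegative l)

  -- The last subscript carries the largest element, and no element is negative, so absolute values
  -- compare as the elements do.
  ∣elem∣<length : ∀ l → ∣ elem P l ∣ ℕ.< length P
  ∣elem∣<length l = s≤s (ℤ.drop‿+≤+ (subst₂ ℤ._≤_ (sym (+∣elem∣ l)) (sym (+∣elem∣ _))
    (elem-mono-≤ (Fin.≤fromℕ l))))

  +elem-first : ∀ t → t ℤ.+ elem P zero ≡ t
  +elem-first t = trans (cong (ℤ._+_ t) (elem-first P)) (ℤ.+-identityʳ t)

length≤maxLength : (𝒫 : Fin K → Prototile) (k : Fin K) → length (𝒫 k) ℕ.≤ maxLength 𝒫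
length≤maxLength 𝒫 zero    = ℕ.m≤m⊔n _ (maxLength (𝒫 ∘ suc))
length≤maxLength 𝒫 (suc k) = ℕ.≤-trans (length≤maxLength (𝒫 ∘ suc) k) (ℕ.m≤n⊔m _ _)

module _ (𝒫 : Fin K → Prototile) where

  infix 4 _≟_
  _≟_ : DecidableEquality (Symbol 𝒫)
  _≟_ = ≡-dec Fin._≟_ Fin._≟_

  symbols : List (Symbol 𝒫)
  symbols = List.concatMap (λ k → List.map (k ,_) (List.allFin (size (𝒫 k)))) (List.allFin K)

  ∈-symbols : ∀ a → a ∈ symbols
  ∈-symbols (k , l) = ∈-concatMap⁺ _ (lose (∈-allFin k) (∈-map⁺ (k ,_) (∈-allFin l)))

  Consistent : (ℤ → Symbol 𝒫) → Set
  Consistent x = ∀ s k l l′ →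
    x (s ℤ.+ elem (𝒫 k) l) ≡ (k , l) → x (s ℤ.+ elem (𝒫 k) l′) ≡ (k , l′)

  -- The symbol seen at `s + p_{k,l}` forces a tile of kind `k` based at `s`. That tile also
  -- contains `s + p_{k,l′}`, so by disjointness it is the tile that labels this point, and
  -- injectivity of the enumeration forces the subscript `l′`.
  tiled⇒consistent : ∀ x → SubscriptedTilingSystem 𝒫 x → Consistent x
  tiled⇒consistent x (τ , sub) s k l l′ xsl with sub (s ℤ.+ elem (𝒫 k) l)
  ... | j , m , pos , xtm with trans (sym xsl) xtm
  ... | refl with ∙-cancelʳ (elem (𝒫 k) l) s (Tiling.t τ j) pos
  ... | refl with sub (s ℤ.+ elem (𝒫 k) l′)
  ... | j′ , m′ , pos′ , xtm′ with Tiling.disjoint τ (l′ , refl) (m′ , pos′)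
  ... | refl with elem-injective (𝒫 k) (∙-cancelˡ s _ _ pos′)
  ... | refl = xtm′

  module _ (x : ℤ → Symbol 𝒫) (consistent : Consistent x) where

    BasePoint : Set
    BasePoint = ∃[ s ] ∃[ k ] x s ≡ (k , zero)

    -- `disjoint` asks for equal indices, proof component included. The kind is read off from `x s`,
    -- and equality proofs between symbols are unique because that equality is decidable.
    BasePoint-≡ : ((s , k , _) (s′ , k′ , _) : BasePoint) → s ≡ s′ →
                  _≡_ {A = BasePoint} (s , k , _) (s′ , k′ , _)
    BasePoint-≡ (s , k , xs) (.s , k′ , xs′) refl with ,-injectiveˡ (trans (sym xs) xs′)
    ... | refl = cong (λ eq → s , k , eq) (Decidable⇒UIP.≡-irrelevant _≟_ xs xs′)

    tileAt : ∀ i → ∃ λ ((s , k , _) : BasePoint) → ∃[ l ] (i ≡ s ℤ.+ elem (𝒫 k) l × x i ≡ (k , l))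
    tileAt i =
      -- Consistency carries the symbol at `i` back to the first subscript, whose element is 0, so
      -- `s` is a base point.
      (s , k , trans (cong x (sym (+elem-first (𝒫 k) s))) (consistent s k l zero xsl)) ,
      l , i≡s+p , refl
      where
      k = proj₁ (x i)
      l = proj₂ (x i)
      s = i ℤ.- elem (𝒫 k) l
      i≡s+p : i ≡ s ℤ.+ elem (𝒫 k) l
      i≡s+p = identity i (elem (𝒫 k) l)
        where
        identity : ∀ i p → i ≡ i ℤ.- p ℤ.+ p
        identity = solve-∀
      xsl : x (s ℤ.+ elem (𝒫 k) l) ≡ (k , l)
      xsl = cong x (sym i≡s+p)

    symbolOnTile : ∀ {i} ((s , k , _) : BasePoint) (l : Fin (size (𝒫 k))) →
                   i ≡ s ℤ.+ elem (𝒫 k) l → x i ≡ (k , l)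
    symbolOnTile (s , k , xs) l refl =
      consistent s k zero l (trans (cong x (+elem-first (𝒫 k) s)) xs)

    -- A common point carries only one symbol; this fixes the kind and the subscript, and
    -- subtracting the element gives the same base.
    disjointTiles : ∀ {i} (b@(s , k , _) b′@(s′ , k′ , _) : BasePoint) →
                    i ∈ s +ₜ 𝒫 k → i ∈ s′ +ₜ 𝒫 k′ → b ≡ b′
    disjointTiles b@(s , _) b′@(s′ , _) (l , pos) (l′ , pos′)
      with trans (sym (symbolOnTile b l pos)) (symbolOnTile b′ l′ pos′)
    ... | refl = BasePoint-≡ b b′ (∙-cancelʳ _ s s′ (trans (sym pos) pos′))

    consistent⇒tiled : SubscriptedTilingSystem 𝒫 x
    consistent⇒tiled = record
      { Index    = BasePoint
      ; t        = proj₁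
      ; kind     = proj₁ ∘ proj₂
      ; covers   = λ i → let (b , l , pos , _) = tileAt i in b , l , pos
      ; disjoint = disjointTiles _ _
      } , tileAt

  -- d is the displacement from the position of (k , l) to that of c.
  Compatible : Symbol 𝒫 → ℤ → Symbol 𝒫 → Set
  Compatible (k , l) d c = ∀ l′ → elem (𝒫 k) l ℤ.+ d ≡ elem (𝒫 k) l′ → c ≡ (k , l′)

  compatible? : ∀ b d c → Dec (Compatible b d c)
  compatible? (k , l) d c =
    Fin.all? λ l′ → (elem (𝒫 k) l ℤ.+ d ℤ.≟ elem (𝒫 k) l′) →-dec (c ≟ (k , l′))

  -- Comparing two positions by displacement avoids naming the base of a tile, which may lie outside
  -- the word, and leaves only finite quantifiers, so the condition is decidable.
  ConsistentWord : Vec (Symbol 𝒫) n → Set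
  ConsistentWord w = ∀ m m′ → Compatible (lookup w m) (+ toℕ m′ ℤ.- + toℕ m) (lookup w m′)

  consistentWord? : (w : Vec (Symbol 𝒫) n) → Dec (ConsistentWord w)
  consistentWord? w = Fin.all? λ m → Fin.all? λ m′ → compatible? (lookup w m) _ (lookup w m′)

  -- The symbol at `m` determines the base `s`, and the displacement equation places `m′` at
  -- `s + p_{k,l′}`.
  consistent⇒word : ∀ x → Consistent x → (w : Vec (Symbol 𝒫) n) → w OccursIn x → ConsistentWord w
  consistent⇒word x consistent w (i , occ) m m′ l′ eq =
    trans (sym (occ m′)) (trans (cong x i+m′≡s+p′)
      (consistent s k l l′ (trans (cong x (sym i+m≡s+p)) (occ m))))
    where
    k = proj₁ (lookup w m)
    l = proj₂ (lookup w m)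
    p = elem (𝒫 k) l
    s = i ℤ.+ + toℕ m ℤ.- p
    i+m≡s+p : i ℤ.+ + toℕ m ≡ s ℤ.+ p
    i+m≡s+p = identity i (+ toℕ m) p
      where
      identity : ∀ i m p → i ℤ.+ m ≡ i ℤ.+ m ℤ.- p ℤ.+ p
      identity = solve-∀
    i+m′≡s+p′ : i ℤ.+ + toℕ m′ ≡ s ℤ.+ elem (𝒫 k) l′
    i+m′≡s+p′ = trans (identity i (+ toℕ m) (+ toℕ m′) p) (cong (ℤ._+_ s) eq)
      where
      identity : ∀ i m m′ p → i ℤ.+ m′ ≡ i ℤ.+ m ℤ.- p ℤ.+ (p ℤ.+ (m′ ℤ.- m))
      identity = solve-∀

  -- The window starts at the base `s` itself: every element of the prototile is at least 0 and
  -- below `maxLength 𝒫`, hence is an index into it.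
  words⇒consistent : ∀ x →
    ((w : Vec (Symbol 𝒫) (maxLength 𝒫)) → w OccursIn x → ConsistentWord w) → Consistent x
  words⇒consistent x good s k l l′ xsl =
    trans (sym (lookup-w l′))
      (subst (λ b → Compatible b (+ toℕ (m l′) ℤ.- + toℕ (m l)) (lookup w (m l′))) (trans (lookup-w l) xsl)
        (good w (window-occurs x s) (m l) (m l′)) l′ displacement)
    where
    w : Vec (Symbol 𝒫) (maxLength 𝒫)
    w = window x s _
    m : Fin (size (𝒫 k)) → Fin (maxLength 𝒫)
    m l = fromℕ< (ℕ.<-≤-trans (∣elem∣<length (𝒫 k) l) (length≤maxLength 𝒫 k))
    +m≡elem : ∀ l → + toℕ (m l) ≡ elem (𝒫 k) l
    +m≡elem l = trans (cong +_ (Fin.toℕ-fromℕ< _)) (+∣elem∣ (𝒫 k) l)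
    lookup-w : ∀ l → lookup w (m l) ≡ x (s ℤ.+ elem (𝒫 k) l)
    lookup-w l = trans (lookup∘tabulate _ (m l)) (cong (λ p → x (s ℤ.+ p)) (+m≡elem l))
    displacement : elem (𝒫 k) l ℤ.+ (+ toℕ (m l′) ℤ.- + toℕ (m l)) ≡ elem (𝒫 k) l′
    displacement = trans
      (cong₂ (λ q q′ → elem (𝒫 k) l ℤ.+ (q′ ℤ.- q)) (+m≡elem l) (+m≡elem l′))
      (identity (elem (𝒫 k) l) (elem (𝒫 k) l′))
      where
      identity : ∀ p p′ → p ℤ.+ (p′ ℤ.- p) ≡ p′
      identity = solve-∀

  inconsistentWords : (n : ℕ) → List (Vec (Symbol 𝒫) n)
  inconsistentWords n = List.filter (¬? ∘ consistentWord?) (words symbols n)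

  -- An inconsistent word would be on the list, since `symbols` exhausts the alphabet; decidability
  -- removes the double negation.
  avoids⇒word : (x : ℤ → Symbol 𝒫) → All (λ w → ¬ (w OccursIn x)) (inconsistentWords n) →
    (w : Vec (Symbol 𝒫) n) → w OccursIn x → ConsistentWord w
  avoids⇒word x avoids w occ = decidable-stable (consistentWord? w) λ bad →
    All.lookup avoids (∈-filter⁺ (¬? ∘ consistentWord?) (∈-words ∈-symbols w) bad) occ

  consistent⇒avoids : (x : ℤ → Symbol 𝒫) → Consistent x →
    All (λ w → ¬ (w OccursIn x)) (inconsistentWords n)
  consistent⇒avoids x consistent =
    All.map (λ {w} bad occ → bad (consistent⇒word x consistent w occ))
      (All.all-filter (¬? ∘ consistentWord?) (words symbols _))

  isShiftOfFiniteType : IsShiftOfFiniteType (SubscriptedTilingSystem 𝒫)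
  isShiftOfFiniteType = List.map (maxLength 𝒫 ,_) (inconsistentWords (maxLength 𝒫)) , λ x → mk⇔
    (All.map⁺ ∘ consistent⇒avoids x ∘ tiled⇒consistent x)
    (consistent⇒tiled x ∘ words⇒consistent x ∘ avoids⇒word x ∘ All.map⁻)

mainTheorem3 : (K : ℕ) (𝒫 : Fin K → Prototile) →
    IsShiftOfFiniteType (SubscriptedTilingSystem 𝒫)
    × ((x : ℤ → Symbol 𝒫) →
    ((w : Vec (Symbol 𝒫) (maxLength 𝒫)) → w OccursIn x →
    ∃[ y ] (SubscriptedTilingSystem 𝒫 y × w OccursIn y)) →
    SubscriptedTilingSystem 𝒫 x)
mainTheorem3 K 𝒫 = isShiftOfFiniteType 𝒫 , λ x allowed →
  -- Consistency of a word does not depend on where it occurs, so it passes from `y` to the windows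
  -- of `x`.
  consistent⇒tiled 𝒫 x (words⇒consistent 𝒫 x λ w occ →
    let (y , tiled , occ′) = allowed w occ in
    consistent⇒word 𝒫 y (tiled⇒consistent 𝒫 y tiled) w occ′)
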